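{- $\mathbf{L}=\mathbb{N}\setminus\mathbf{M}$ is $\Pi^0_1$-complete and productive: there is a total computable $\psi$ such that whenever $W_e\subseteq\mathbf{L}$, we have $\psi(e)\in\mathbf{L}\setminus W_e$. Relativised: for every $X\subseteq\mathbb{N}$, $\mathbf{M}^X$ is $\Sigma^{0,X}_1$-complete and $\mathbf{L}^X=\mathbb{N}\setminus\mathbf{M}^X$ is $\Pi^{0,X}_1$-complete and $X$-productive.
   Context: $(\varphi_e)_{e\in\mathbb{N}}$ is a fixed standard acceptable numbering of the unary partial computable functions, $W_e=\operatorname{dom}\varphi_e$, and $\mathbf{M}=\{p\in\mathbb{N}:\varphi_p(0)\!\downarrow=1\}$. For $X\subseteq\mathbb{N}$, $(\varphi^X_e)$ is the standard enumeration of the unary $X$-partial computable functions and $\mathbf{M}^X=\{p:\varphi^X_p(0)\!\downarrow=1\}$. $\Sigma^{0,X}_1$ and $\Pi^{0,X}_1$ are the arithmetical classes relativised to $X$. $X$-productivity is the relativisation of productivity to $X$: with $W^X_e=\operatorname{dom}\varphi^X_e$ in place of $W_e$ (and productive function computable in $X$). -}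

module Defs where

open import Data.Empty using (⊥)
open import Data.Fin using (Fin)
open import Data.Nat using (ℕ; zero; suc; _<_)
open import Data.Product using (∃-syntax; _×_)
open import Data.Sum using (_⊎_)
open import Data.Unit using (⊤)
open import Data.Vec using (Vec; []; _∷_; lookup)
open import Data.Vec.Relation.Binary.Pointwise.Inductive using (Pointwise)
open import Function.Bundles using (_⇔_)
open import Level using (0ℓ)
open import Relation.Nullary using (¬_)
open import Relation.Unary using (Pred; _∈_; _⊆_; ∁; _∖_)

-- Definitions of n-ary partial recursive functions relative to a family of
-- oracle sets indexed by O.  Taking O = ⊥ gives the ordinary partial computable
-- functions, O = ⊤ those computable relative to a single set.
data Code (O : Set) : ℕ → Set where
  zer    : Code O 0
  succ   : Code O 1
  proj   : ∀ {n} → Fin n → Code O n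
  oracle : O → Code O 1
  comp   : ∀ {m n} → Code O m → Vec (Code O n) m → Code O n
  prec   : ∀ {n} → Code O n → Code O (suc (suc n)) → Code O (suc n)
  mu     : ∀ {n} → Code O (suc n) → Code O n

Oracles : Set → Set₁
Oracles O = O → Pred ℕ 0ℓ

noOracle : Oracles ⊥
noOracle ()

oracleFor : Pred ℕ 0ℓ → Oracles ⊤
oracleFor X _ = X

-- X ⊢ c ⟨ xs ⟩↓ y : the function defined by c, with oracle calls answered by
-- the characteristic functions of the sets X o, converges on xs with value y.
data _⊢_⟨_⟩↓_ {O : Set} (X : Oracles O) :
       ∀ {n} → Code O n → Vec ℕ n → ℕ → Set where
  zer↓   : X ⊢ zer ⟨ [] ⟩↓ 0
  succ↓  : ∀ {x} → X ⊢ succ ⟨ x ∷ [] ⟩↓ suc x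
  proj↓  : ∀ {n} {i : Fin n} {xs} → X ⊢ proj i ⟨ xs ⟩↓ lookup xs i
  in↓    : ∀ {o x} → X o x → X ⊢ oracle o ⟨ x ∷ [] ⟩↓ 1
  out↓   : ∀ {o x} → ¬ X o x → X ⊢ oracle o ⟨ x ∷ [] ⟩↓ 0
  comp↓  : ∀ {m n} {c : Code O m} {ds : Vec (Code O n) m} {xs ys z} →
           Pointwise (λ d y → X ⊢ d ⟨ xs ⟩↓ y) ds ys →
           X ⊢ c ⟨ ys ⟩↓ z →
           X ⊢ comp c ds ⟨ xs ⟩↓ z
  prec0↓ : ∀ {n} {c : Code O n} {d xs y} →
           X ⊢ c ⟨ xs ⟩↓ y →
           X ⊢ prec c d ⟨ zero ∷ xs ⟩↓ y
  precS↓ : ∀ {n} {c : Code O n} {d k xs y z} →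
           X ⊢ prec c d ⟨ k ∷ xs ⟩↓ y →
           X ⊢ d ⟨ k ∷ y ∷ xs ⟩↓ z →
           X ⊢ prec c d ⟨ suc k ∷ xs ⟩↓ z
  mu↓    : ∀ {n} {c : Code O (suc n)} {xs y} →
           (∀ i → i < y → ∃[ k ] X ⊢ c ⟨ i ∷ xs ⟩↓ suc k) →
           X ⊢ c ⟨ y ∷ xs ⟩↓ 0 →
           X ⊢ mu c ⟨ xs ⟩↓ y

module _ {O : Set} (X : Oracles O) where

  Computable : (ℕ → ℕ) → Set
  Computable f = ∃[ c ] ∀ x → X ⊢ c ⟨ x ∷ [] ⟩↓ f x

  -- The characteristic function of R is total and computable.
  ComputableRel : (ℕ → ℕ → Set) → Set
  ComputableRel R = ∃[ c ] ∀ n m →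
    (R n m × X ⊢ c ⟨ n ∷ m ∷ [] ⟩↓ 1) ⊎ (¬ R n m × X ⊢ c ⟨ n ∷ m ∷ [] ⟩↓ 0)

  Σ₁ : Pred ℕ 0ℓ → Set₁
  Σ₁ A = ∃[ R ] ComputableRel R × (∀ n → n ∈ A ⇔ (∃[ m ] R n m))

  Π₁ : Pred ℕ 0ℓ → Set₁
  Π₁ A = ∃[ R ] ComputableRel R × (∀ n → n ∈ A ⇔ (∀ m → R n m))

infix 4 _≤ₘ_

_≤ₘ_ : Pred ℕ 0ℓ → Pred ℕ 0ℓ → Set
B ≤ₘ A = ∃[ f ] Computable noOracle f × (∀ n → n ∈ B ⇔ f n ∈ A)

-- Hardness is under many-one reductions by computable functions, also when
-- the class Γ is relativised to an oracle.
CompleteFor : (Pred ℕ 0ℓ → Set₁) → Pred ℕ 0ℓ → Set₁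
CompleteFor Γ A = Γ A × (∀ B → Γ B → B ≤ₘ A)

-- A sequence of unary partial functions given by graphs: φ e x y is φₑ(x)↓ = y.
Numbering : Set₁
Numbering = ℕ → ℕ → ℕ → Set

-- Acceptable numberings in the sense of Rogers, relative to X.  The
-- parametrisation functions are computable without oracle, as in the
-- relativised s-m-n theorem for the standard enumeration.
record Acceptable {O : Set} (X : Oracles O) (φ : Numbering) : Set where
  field
    onto      : ∀ (c : Code O 1) →
                ∃[ e ] ∀ x y → φ e x y ⇔ X ⊢ c ⟨ x ∷ [] ⟩↓ y
    universal : ∃[ u ] ∀ e x y → φ e x y ⇔ X ⊢ u ⟨ e ∷ x ∷ [] ⟩↓ y
    smn       : ∀ (c : Code O 2) →
                ∃[ s ] Computable noOracle s ×
                  (∀ e x y → φ (s e) x y ⇔ X ⊢ c ⟨ e ∷ x ∷ [] ⟩↓ y)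

W : Numbering → ℕ → Pred ℕ 0ℓ
W φ e x = ∃[ y ] φ e x y

Productive : {O : Set} → Oracles O → Numbering → Pred ℕ 0ℓ → Set
Productive X φ A =
  ∃[ ψ ] Computable X ψ × (∀ e → W φ e ⊆ A → ψ e ∈ A ∖ W φ e)

M : Numbering → Pred ℕ 0ℓ
M φ p = φ p 0 1

L : Numbering → Pred ℕ 0ℓ
L φ = ∁ (M φ)

{-# OPTIONS --safe #-}

-- Evaluating a code with a bound s on every mu-search gives a total function,
-- itself computed by a code, whose value is eventually constant in s; so graphs
-- of partial computable functions are Σ₁.  Conversely a Σ₁ set is the domain of a
-- mu-search, and s-m-n turns "the search from n succeeds" into φ_{f n}(0) = 1.
-- For productivity, let f reduce the halting set {e : φₑ(e)↓} to M and let s(e) be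
-- an index of f⁻¹(Wₑ).  If Wₑ ⊆ L, then f(s(e)) ∈ Wₑ iff s(e) ∈ W_{s(e)} iff
-- f(s(e)) ∈ M, so f(s(e)) lies in neither Wₑ nor M.
module Submission where

open import Defs
open import Axiom.ExcludedMiddle using (ExcludedMiddle)
open import Data.Empty using (⊥)
open import Data.Fin using (Fin; zero; suc; _↑ʳ_)
open import Data.Nat
  using (ℕ; zero; suc; pred; _+_; _≤_; _<_; _⊔_)
open import Data.Nat.Induction using (<-rec)
open import Data.Nat.Properties
  using (≤-refl; m⊔n≤o⇒m≤o; m⊔n≤o⇒n≤o; m<1+n⇒m<n∨m≡n; m≤n⇒m≤1+n; <⇒≤;
         anyUpTo?; suc-injective; 0≢1+n)
open import Data.Product using (∃-syntax; _×_; _,_; proj₁; proj₂; map₂)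
open import Data.Sum using (_⊎_; inj₁; inj₂; [_,_]′)
open import Data.Vec using (Vec; []; _∷_; _++_; map; lookup; tabulate; drop)
open import Data.Vec.Relation.Binary.Pointwise.Inductive
  using (Pointwise; []; _∷_; ++⁺)
open import Function.Base using (_∘_)
open import Function.Bundles using (_⇔_; mk⇔; Equivalence)
open import Level using (0ℓ)
open import Relation.Binary.PropositionalEquality
  using (_≡_; refl; sym; trans; cong; subst)
open import Relation.Nullary using (¬_; Dec; yes; no; contradiction)
open import Relation.Nullary.Decidable using (decidable-stable)
open import Relation.Unary using (Pred; _∈_; _⊆_; ∁)

open Equivalence using (to; from)

-- Eventual properties of stages

-- Asking for all stages from `s₀` on, rather than for one stage, closes these properties under
-- finite conjunction, which is how the premises of a derivation get a common stage.
Eventually : Pred ℕ 0ℓ → Set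
Eventually P = ∃[ s₀ ] ∀ s → s₀ ≤ s → P s

Eventually-always : ∀ {P : Pred ℕ 0ℓ} → (∀ s → P s) → Eventually P
Eventually-always p = 0 , λ s _ → p s

Eventually-map : ∀ {P Q : Pred ℕ 0ℓ} → P ⊆ Q → Eventually P → Eventually Q
Eventually-map f (s₀ , p) = s₀ , λ s s₀≤s → f (p s s₀≤s)

Eventually-× : ∀ {P Q : Pred ℕ 0ℓ} → Eventually P → Eventually Q →
               Eventually (λ s → P s × Q s)
Eventually-× (s₀ , p) (s₁ , q) = s₀ ⊔ s₁ , λ s b →
  p s (m⊔n≤o⇒m≤o s₀ s₁ b) , q s (m⊔n≤o⇒n≤o s₀ s₁ b)

Eventually-∀< : ∀ {P : ℕ → Pred ℕ 0ℓ} n → (∀ i → i < n → Eventually (P i)) →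
                Eventually (λ s → ∀ i → i < n → P i s)
Eventually-∀< zero    p = Eventually-always λ _ _ ()
Eventually-∀< {P} (suc n) p = Eventually-map extend
  (Eventually-× (Eventually-∀< {P} n λ i i<n → p i (m≤n⇒m≤1+n i<n)) (p n ≤-refl))
  where
  extend : ∀ {s} → (∀ i → i < n → P i s) × P n s → ∀ i → i < suc n → P i s
  extend (ps , pn) i i<1+n with m<1+n⇒m<n∨m≡n i<1+n
  ... | inj₁ i<n  = ps i i<n
  ... | inj₂ refl = pn

-- Well-founded descent: a bounded search below a witness either finds a smaller witness or shows
-- this one to be least.
least : ∀ {P : Pred ℕ 0ℓ} → (∀ m → Dec (P m)) → ∀ m → P m →
        ∃[ y ] P y × (∀ i → i < y → ¬ P i)
least {P} P? = <-rec _ case-below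
  where
  case-below : ∀ m →
    (∀ {i} → i < m → P i → ∃[ y ] P y × (∀ i → i < y → ¬ P i)) →
    P m → ∃[ y ] P y × (∀ i → i < y → ¬ P i)
  case-below m rec Pm with anyUpTo? P? m
  ... | yes (_ , i<m , Pi) = rec i<m Pi
  ... | no none            = m , Pm , λ i i<m Pi → none (i , i<m , Pi)

-- Bounded minimisation

cond : ℕ → ℕ → ℕ → ℕ
cond zero    a b = a
cond (suc _) a b = b

cond-0-suc : ∀ v {e y} → cond v 0 e ≡ suc y → v ≡ suc (pred v) × e ≡ suc y
cond-0-suc (suc v) eq = refl , eq

-- Results of a computation cut off after s steps are coded as 0 (no result) and
-- suc y (result y).  Scanning the coded results e 0, e 1, … for the result 0 is
-- in state 0 while the search goes on, in state 1 once it has met a missing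
-- result, and in state 2 + y once it has found y.
verdict : ℕ → ℕ → ℕ → ℕ
verdict r e b = cond r (cond e 1 (cond (pred e) (suc (suc b)) 0)) r

scan : (ℕ → ℕ) → ℕ → ℕ
scan e zero    = 0
scan e (suc b) = verdict (scan e b) (e b) b

-- A nonzero state never changes, and from state 0 only a result of the form `suc (suc k)` keeps the
-- search going.
scan-searching : ∀ e b → scan e b ≡ 0 → ∀ i → i < b → ∃[ k ] e i ≡ suc (suc k)
scan-searching e (suc b) eq i i<1+b with scan e b in eqᵇ | e b in eqᵉ
... | zero | suc (suc k) with m<1+n⇒m<n∨m≡n i<1+b
...   | inj₁ i<b  = scan-searching e b eqᵇ i i<b
...   | inj₂ refl = k , eqᵉ

scan-found : ∀ e b {y} → scan e b ≡ suc (suc y) →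
             (∀ i → i < y → ∃[ k ] e i ≡ suc (suc k)) × e y ≡ 1
scan-found e (suc b) eq with scan e b in eqᵇ | e b in eqᵉ
scan-found e (suc b) refl | zero | suc zero = scan-searching e b eqᵇ , eqᵉ
scan-found e (suc b) refl | suc _ | _ = scan-found e b eqᵇ

module _ (e : ℕ → ℕ) {y} (below : ∀ i → i < y → ∃[ k ] e i ≡ suc (suc k)) where

  scan-below : ∀ b → b ≤ y → scan e b ≡ 0
  scan-below zero    _   = refl
  scan-below (suc b) b<y
    rewrite scan-below b (<⇒≤ b<y) | proj₂ (below b b<y) = refl

  scan-above : e y ≡ 1 → ∀ b → y < b → scan e b ≡ suc (suc y)
  scan-above ey (suc b) y<1+b with m<1+n⇒m<n∨m≡n y<1+b
  ... | inj₁ y<b  rewrite scan-above ey b y<b = refl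
  ... | inj₂ refl rewrite scan-below y ≤-refl | ey = refl

module _ {O : Set} (X : Oracles O) where

  _⟨_⟩↓*_ : ∀ {m n} → Vec (Code O n) m → Vec ℕ n → Vec ℕ m → Set
  _⟨_⟩↓*_ ds xs ys = Pointwise (λ d y → X ⊢ d ⟨ xs ⟩↓ y) ds ys

  -- Total functions with codes

  -- Carrying the Agda function beside its code lets facts about values be proved by reducing `fn`,
  -- without handling derivations.
  record Total (n : ℕ) : Set where
    field
      fn       : Vec ℕ n → ℕ
      code     : Code O n
      computes : ∀ xs → X ⊢ code ⟨ xs ⟩↓ fn xs

  open Total

  codes-compute : ∀ {m n} (gs : Vec (Total n) m) xs →
                  map code gs ⟨ xs ⟩↓* map (λ g → fn g xs) gs
  codes-compute []       xs = []
  codes-compute (g ∷ gs) xs = computes g xs ∷ codes-compute gs xs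

  projection : ∀ {n} → Fin n → Total n
  projection i = record
    { fn = λ xs → lookup xs i ; code = proj i ; computes = λ _ → proj↓ }

  compose : ∀ {m n} → Total m → Vec (Total n) m → Total n
  compose f gs = record
    { fn       = λ xs → fn f (map (λ g → fn g xs) gs)
    ; code     = comp (code f) (map code gs)
    ; computes = λ xs → comp↓ (codes-compute gs xs) (computes f _)
    }

  projections-compute : ∀ {m n} (h : Fin m → Fin n) ys {xs} →
                        (∀ i → lookup xs (h i) ≡ lookup ys i) →
                        tabulate (proj ∘ h) ⟨ xs ⟩↓* ys
  projections-compute h []       eq = []
  projections-compute h (y ∷ ys) eq =
    subst (X ⊢ proj (h zero) ⟨ _ ⟩↓_) (eq zero) proj↓ ∷
    projections-compute (h ∘ suc) ys (eq ∘ suc)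

  lookup-↑ʳ : ∀ m {n} (xs : Vec ℕ (m + n)) i →
              lookup xs (m ↑ʳ i) ≡ lookup (drop m xs) i
  lookup-↑ʳ zero    xs       i = refl
  lookup-↑ʳ (suc m) (x ∷ xs) i = lookup-↑ʳ m xs i

  -- Replaces the leading `m` arguments by computed ones and passes the rest on, so that stages and
  -- recursion variables can be rearranged over a parameter tuple of any length.
  composeFront : ∀ m {k n} → Total (k + n) → Vec (Total (m + n)) k → Total (m + n)
  composeFront m f gs = record
    { fn       = λ xs → fn f (map (λ g → fn g xs) gs ++ drop m xs)
    ; code     = comp (code f) (map code gs ++ tabulate (proj ∘ (m ↑ʳ_)))
    ; computes = λ xs → comp↓
        (++⁺ (codes-compute gs xs)
             (projections-compute (m ↑ʳ_) (drop m xs) (lookup-↑ʳ m xs)))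
        (computes f _)
    }

  primRec : ∀ {n} → Total n → Total (suc (suc n)) → Total (suc n)
  primRec {n} f g = record
    { fn = λ { (k ∷ xs) → rec k xs } ; code = prec (code f) (code g)
    ; computes = λ { (k ∷ xs) → rec-computes k xs } }
    where
    rec : ℕ → Vec ℕ n → ℕ
    rec zero    xs = fn f xs
    rec (suc k) xs = fn g (k ∷ rec k xs ∷ xs)
    rec-computes : ∀ k xs → X ⊢ prec (code f) (code g) ⟨ k ∷ xs ⟩↓ rec k xs
    rec-computes zero    xs = prec0↓ (computes f xs)
    rec-computes (suc k) xs = precS↓ (rec-computes k xs) (computes g _)

  successor : ∀ {n} → Total n → Total n
  successor g = compose
    (record { fn = λ { (x ∷ []) → suc x } ; code = succ
            ; computes = λ { (x ∷ []) → succ↓ } })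
    (g ∷ [])

  constant : ∀ {n} → ℕ → Total n
  constant k = record
    { fn = λ _ → k ; code = numeral k ; computes = λ _ → numeral-computes k }
    where
    numeral : ∀ {n} → ℕ → Code O n
    numeral zero    = comp zer []
    numeral (suc k) = comp succ (numeral k ∷ [])
    numeral-computes : ∀ {n} k {xs : Vec ℕ n} → X ⊢ numeral k ⟨ xs ⟩↓ k
    numeral-computes zero    = comp↓ [] zer↓
    numeral-computes (suc k) = comp↓ (numeral-computes k ∷ []) succ↓

  predecessor : ∀ {n} → Total n → Total n
  predecessor g = compose
    (record { fn = λ { (x ∷ []) → pred x } ; code = prec zer (proj zero)
            ; computes = λ { (x ∷ []) → pred-computes x } })
    (g ∷ [])
    where
    pred-computes : ∀ x → X ⊢ prec zer (proj zero) ⟨ x ∷ [] ⟩↓ pred x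
    pred-computes zero    = prec0↓ zer↓
    pred-computes (suc x) = precS↓ (pred-computes x) proj↓

  -- A primitive recursion used as a case distinction: its step sees the predecessor, the previous
  -- value, `a` and `b`, so index 3 is `b`.
  condCode : Code O 3
  condCode = prec (proj zero) (proj (suc (suc (suc zero))))

  condCode-computes : ∀ v a b → X ⊢ condCode ⟨ v ∷ a ∷ b ∷ [] ⟩↓ cond v a b
  condCode-computes zero    a b = prec0↓ proj↓
  condCode-computes (suc v) a b = precS↓ (condCode-computes v a b) proj↓

  conditional : ∀ {n} → Total n → Total n → Total n → Total n
  conditional f g h = compose
    (record { fn = λ { (v ∷ a ∷ b ∷ []) → cond v a b } ; code = condCode
            ; computes = λ { (v ∷ a ∷ b ∷ []) → condCode-computes v a b } })
    (f ∷ g ∷ h ∷ [])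

  equals : ∀ {n} → ℕ → Total n → Total n
  equals zero    v = conditional v (constant 1) (constant 0)
  equals (suc k) v = conditional v (constant 0) (equals k (predecessor v))

  equals-correct : ∀ {n} k (v : Total n) xs →
                   (fn v xs ≡ k × fn (equals k v) xs ≡ 1)
                   ⊎ (¬ fn v xs ≡ k × fn (equals k v) xs ≡ 0)
  equals-correct zero v xs with fn v xs
  ... | zero  = inj₁ (refl , refl)
  ... | suc _ = inj₂ ((λ ()) , refl)
  equals-correct (suc k) v xs with fn v xs | equals-correct k (predecessor v) xs
  ... | zero  | _                  = inj₂ ((λ ()) , refl)
  ... | suc _ | inj₁ (eq , to-1)   = inj₁ (cong suc eq , to-1)
  ... | suc _ | inj₂ (neq , to-0)  = inj₂ (neq ∘ suc-injective , to-0)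

  -- Models strictness of composition: one missing inner result, coded 0, makes the whole result 0
  -- even where its value would be ignored.
  guarded : ∀ {m n} → Vec (Total n) m → Total n → Total n
  guarded []       e = e
  guarded (v ∷ vs) e = conditional v (constant 0) (guarded vs e)

  guarded-suc⁻ : ∀ {m n} (vs : Vec (Total n) m) e xs {y} →
                 fn (guarded vs e) xs ≡ suc y →
                 Pointwise (λ v z → fn v xs ≡ suc z) vs
                   (map (λ v → fn (predecessor v) xs) vs)
                 × fn e xs ≡ suc y
  guarded-suc⁻ []       e xs eq = [] , eq
  guarded-suc⁻ (v ∷ vs) e xs eq =
    let v-suc , eq′  = cond-0-suc (fn v xs) eq
        vs-suc , eq″ = guarded-suc⁻ vs e xs eq′
    in v-suc ∷ vs-suc , eq″

  guarded-suc⁺ : ∀ {m n} {vs : Vec (Total n) m} {e xs y}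
                   {zs : Vec ℕ m} →
                 Pointwise (λ v z → fn v xs ≡ suc z) vs zs →
                 fn e xs ≡ suc y → fn (guarded vs e) xs ≡ suc y
  guarded-suc⁺ []         eq = eq
  guarded-suc⁺ (v-suc ∷ vs-suc) eq rewrite v-suc = guarded-suc⁺ vs-suc eq

  predecessors : ∀ {m n} {vs : Vec (Total n) m} {xs} {zs : Vec ℕ m} →
                 Pointwise (λ v z → fn v xs ≡ suc z) vs zs →
                 map (λ g → fn g xs) (map predecessor vs) ≡ zs
  predecessors []               = refl
  predecessors (v-suc ∷ vs-suc)
    rewrite v-suc | predecessors vs-suc = refl

  map-predecessor : ∀ {m n} (vs : Vec (Total n) m) xs →
                    map (λ v → fn (predecessor v) xs) vs
                    ≡ map (λ g → fn g xs) (map predecessor vs)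
  map-predecessor []       xs = refl
  map-predecessor (v ∷ vs) xs = cong (_ ∷_) (map-predecessor vs xs)

  -- Evaluation in stages

  module Stages (X? : ∀ o x → Dec (X o x)) where

    characteristic : O → Total 1
    characteristic o = record
      { fn = λ { (x ∷ []) → χ (X? o x) } ; code = oracle o
      ; computes = λ { (x ∷ []) → χ-computes (X? o x) } }
      where
      χ : ∀ {x} → Dec (X o x) → ℕ
      χ (yes _) = 1
      χ (no  _) = 0
      χ-computes : ∀ {x} (d : Dec (X o x)) → X ⊢ oracle o ⟨ x ∷ [] ⟩↓ χ d
      χ-computes (yes p) = in↓ p
      χ-computes (no ¬p) = out↓ ¬p

    #0 : ∀ {n} → Total (1 + n)
    #0 = projection zero
    #1 : ∀ {n} → Total (2 + n)
    #1 = projection (suc zero)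
    #2 : ∀ {n} → Total (3 + n)
    #2 = projection (suc (suc zero))

    -- The first argument of run c is the stage, and its values are coded
    -- results.
    run  : ∀ {n} → Code O n → Total (suc n)
    runs : ∀ {m n} → Vec (Code O n) m → Vec (Total (suc n)) m
    search : ∀ {n} → Code O (suc n) → Total (suc (suc n))

    run zer         = constant 1
    run succ        = successor (successor #1)
    run (proj i)    = successor (projection (suc i))
    run (oracle o)  = successor (compose (characteristic o) (#1 ∷ []))
    run (comp c ds) =
      guarded (runs ds) (compose (run c) (#0 ∷ map predecessor (runs ds)))
    -- `primRec` recurses on its first argument, so stage and recursion variable are swapped. The
    -- inner step sees the recursion variable, the previous coded result and the stage; a missing
    -- previous result stays missing.
    run (prec c d)  = composeFront 2
      (primRec (run c)
        (conditional #1 (constant 0)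
          (composeFront 3 (run d) (#2 ∷ #0 ∷ predecessor #1 ∷ []))))
      (#1 ∷ #0 ∷ [])
    -- The stage serves both as search bound and as stage for `c`. The predecessor sends states 0
    -- and 1 to "no result" and state 2 + y to the coded result of y.
    run (mu c)      = predecessor (composeFront 1 (search c) (#0 ∷ #0 ∷ []))

    runs []       = []
    runs (d ∷ ds) = run d ∷ runs ds

    -- The step sees the position, the state and the stage, and is `verdict` written with total
    -- codes.
    search c = primRec (constant 0)
      (conditional #1
        (conditional e (constant 1)
          (conditional (predecessor e) (successor (successor #0)) (constant 0)))
        #1)
      where e = composeFront 3 (run c) (#2 ∷ #0 ∷ [])

    stage : ∀ {n} → Code O n → Vec ℕ n → ℕ → ℕ
    stage c xs s = fn (run c) (s ∷ xs)

    search-scan : ∀ {n} (c : Code O (suc n)) b s xs →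
                  fn (search c) (b ∷ s ∷ xs)
                  ≡ scan (λ i → stage c (i ∷ xs) s) b
    search-scan c zero    s xs = refl
    search-scan c (suc b) s xs rewrite search-scan c b s xs = refl

    -- Induction on the code: a positive coded result forces the results it depends on to be
    -- positive at the same stage. Primitive recursion needs an inner induction on `k`.
    stage-sound  : ∀ {n} (c : Code O n) {xs} s {y} →
                   stage c xs s ≡ suc y → X ⊢ c ⟨ xs ⟩↓ y
    stages-sound : ∀ {m n} (ds : Vec (Code O n) m) {xs} s {ys} →
                   Pointwise (λ v y → fn v (s ∷ xs) ≡ suc y) (runs ds) ys →
                   ds ⟨ xs ⟩↓* ys
    prec-sound   : ∀ {n} (c : Code O n) d k {xs} s {y} →
                   stage (prec c d) (k ∷ xs) s ≡ suc y →
                   X ⊢ prec c d ⟨ k ∷ xs ⟩↓ y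

    stage-sound zer        {[]}     s refl = zer↓
    stage-sound succ       {x ∷ []} s refl = succ↓
    stage-sound (proj i)   {xs}     s refl = proj↓
    stage-sound (oracle o) {x ∷ []} s refl = computes (characteristic o) (x ∷ [])
    stage-sound (comp c ds) {xs} s {y} eq =
      let ds-suc , c-suc = guarded-suc⁻ (runs ds) _ (s ∷ xs) eq
      in comp↓ (stages-sound ds s ds-suc)
               (stage-sound c s (trans
                 (cong (λ ys → stage c ys s) (map-predecessor (runs ds) (s ∷ xs)))
                 c-suc))
    stage-sound (prec c d) {k ∷ xs} s eq = prec-sound c d k s eq
    stage-sound (mu c) {xs} s eq rewrite search-scan c s s xs
      with scan (λ i → stage c (i ∷ xs) s) s in found
    -- States 0 and 1 have predecessor 0, so a positive result leaves only the state of a successful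
    -- search.
    stage-sound (mu c) {xs} s refl | suc (suc y) =
      let below , here = scan-found _ s found
      in mu↓ (λ i i<y → map₂ (stage-sound c s) (below i i<y)) (stage-sound c s here)

    stages-sound []       s []         = []
    stages-sound (d ∷ ds) s (eq ∷ eqs) = stage-sound d s eq ∷ stages-sound ds s eqs

    prec-sound c d zero    s eq = prec0↓ (stage-sound c s eq)
    prec-sound c d (suc k) {xs} s eq =
      let k-suc , eq′ = cond-0-suc (stage (prec c d) (k ∷ xs) s) eq
      in precS↓ (prec-sound c d k s k-suc) (stage-sound d s eq′)

    -- Induction on the derivation: each rule has finitely many premises, hence a stage from which
    -- all of them are witnessed.
    stage-complete  : ∀ {n} {c : Code O n} {xs y} → X ⊢ c ⟨ xs ⟩↓ y →
                      Eventually (λ s → stage c xs s ≡ suc y)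
    stages-complete : ∀ {m n} {ds : Vec (Code O n) m} {xs ys} → ds ⟨ xs ⟩↓* ys →
                      Eventually (λ s →
                        Pointwise (λ v y → fn v (s ∷ xs) ≡ suc y) (runs ds) ys)
    stage-complete zer↓  = Eventually-always λ _ → refl
    stage-complete succ↓ = Eventually-always λ _ → refl
    stage-complete proj↓ = Eventually-always λ _ → refl
    stage-complete (in↓ {o} {x} p) = Eventually-always λ _ → χ-yes
      where
      χ-yes : suc (fn (characteristic o) (x ∷ [])) ≡ 2
      χ-yes with X? o x
      ... | yes _ = refl
      ... | no ¬p = contradiction p ¬p
    stage-complete (out↓ {o} {x} ¬p) = Eventually-always λ _ → χ-no
      where
      χ-no : suc (fn (characteristic o) (x ∷ [])) ≡ 1
      χ-no with X? o x
      ... | yes p = contradiction p ¬p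
      ... | no _  = refl
    stage-complete (comp↓ {c = c} ds↓ c↓) = Eventually-map
      (λ {s} (ds-suc , c-suc) → guarded-suc⁺ ds-suc
        (trans (cong (λ ys → stage c ys s) (predecessors ds-suc)) c-suc))
      (Eventually-× (stages-complete ds↓) (stage-complete c↓))
    stage-complete (prec0↓ c↓) = stage-complete c↓
    stage-complete (precS↓ {c = c} {d} {k} {xs} {y} {z} k↓ d↓) = Eventually-map
      (λ {s} (k-suc , d-suc) → prec-suc s k-suc d-suc)
      (Eventually-× (stage-complete k↓) (stage-complete d↓))
      where
      prec-suc : ∀ s → stage (prec c d) (k ∷ xs) s ≡ suc y →
                 stage d (k ∷ y ∷ xs) s ≡ suc z →
                 stage (prec c d) (suc k ∷ xs) s ≡ suc z
      prec-suc s k-suc d-suc rewrite k-suc = d-suc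
    stage-complete (mu↓ {c = c} {xs} {y} below here) = Eventually-map
      (λ {s} (y<s , below-suc , here-suc) →
        trans (cong pred (search-scan c s s xs))
              (cong pred (scan-above _ below-suc here-suc s y<s)))
      -- The bound must exceed y for the scan to examine position y.
      (Eventually-× (suc y , λ _ y<s → y<s)
        (Eventually-×
          (Eventually-∀< y λ i i<y →
            let k , c↓ = below i i<y in Eventually-map (k ,_) (stage-complete c↓))
          (stage-complete here)))
    stages-complete []         = Eventually-always λ _ → []
    stages-complete (d↓ ∷ ds↓) = Eventually-map (λ (eq , eqs) → eq ∷ eqs)
      (Eventually-× (stage-complete d↓) (stages-complete ds↓))

    -- Both values are read off the same total function at a common stage.
    deterministic : ∀ {n} {c : Code O n} {xs y z} →
                    X ⊢ c ⟨ xs ⟩↓ y → X ⊢ c ⟨ xs ⟩↓ z → y ≡ z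
    deterministic y↓ z↓ =
      let s₀ , both = Eventually-× (stage-complete y↓) (stage-complete z↓)
          y-suc , z-suc = both s₀ ≤-refl
      in suc-injective (trans (sym y-suc) z-suc)

    -- The stage is the second argument, the variable to be quantified over in a Σ₁ definition.
    ComputableRel-stage : ∀ (c : Code O 2) x v →
      ComputableRel X (λ n s → stage c (n ∷ x ∷ []) s ≡ v)
    ComputableRel-stage c x v = code (equals v result) , λ n s →
      decide (computes (equals v result) (n ∷ s ∷ []))
             (equals-correct v result (n ∷ s ∷ []))
      where
      result : Total 2
      result = compose (run c) (#1 ∷ #0 ∷ constant x ∷ [])
      decide : ∀ {P : Set} {d : Code O 2} {xs z} → X ⊢ d ⟨ xs ⟩↓ z →
               (P × z ≡ 1) ⊎ (¬ P × z ≡ 0) →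
               (P × X ⊢ d ⟨ xs ⟩↓ 1) ⊎ (¬ P × X ⊢ d ⟨ xs ⟩↓ 0)
      decide d↓ (inj₁ (p , refl))  = inj₁ (p , d↓)
      decide d↓ (inj₂ (¬p , refl)) = inj₂ (¬p , d↓)

  -- Σ₁ and Π₁ relations

  ComputableRel⇒Dec : ∀ {R} → ComputableRel X R → ∀ n m → Dec (R n m)
  ComputableRel⇒Dec (_ , correct) n m =
    [ yes ∘ proj₁ , no ∘ proj₁ ]′ (correct n m)

  ComputableRel-¬ : ∀ {R} → ComputableRel X R → ComputableRel X (λ n m → ¬ R n m)
  ComputableRel-¬ (c , correct) = c̄ , λ n m → flip (correct n m)
    where
    c̄ : Code O 2
    c̄ = comp condCode (c ∷ code (constant {2} 1) ∷ code (constant {2} 0) ∷ [])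
    c̄-computes : ∀ {xs v} → X ⊢ c ⟨ xs ⟩↓ v → X ⊢ c̄ ⟨ xs ⟩↓ cond v 1 0
    c̄-computes c↓ = comp↓
      (c↓ ∷ computes (constant 1) _ ∷ computes (constant 0) _ ∷ [])
      (condCode-computes _ 1 0)
    flip : ∀ {P : Set} {xs} →
           (P × X ⊢ c ⟨ xs ⟩↓ 1) ⊎ (¬ P × X ⊢ c ⟨ xs ⟩↓ 0) →
           (¬ P × X ⊢ c̄ ⟨ xs ⟩↓ 1) ⊎ (¬ ¬ P × X ⊢ c̄ ⟨ xs ⟩↓ 0)
    flip (inj₁ (p , c↓))  = inj₂ (contradiction p , c̄-computes c↓)
    flip (inj₂ (¬p , c↓)) = inj₁ (¬p , c̄-computes c↓)

  Σ₁⇒Π₁-∁ : ∀ {A} → Σ₁ X A → Π₁ X (∁ A)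
  Σ₁⇒Π₁-∁ (R , R-computable , A⇔∃R) =
    (λ n m → ¬ R n m) , ComputableRel-¬ R-computable , λ n → mk⇔
      (λ n∉A m Rnm → n∉A (from (A⇔∃R n) (m , Rnm)))
      (λ ∀¬R n∈A → let m , Rnm = to (A⇔∃R n) n∈A in ∀¬R m Rnm)

  -- Membership in `M` asks for the value 1, so convergence with an arbitrary value is normalised to
  -- 1.
  oneOnDomain : ∀ {n} → Code O n → Code O n
  oneOnDomain d = comp (code (constant {1} 1)) (d ∷ [])

  oneOnDomain⁺ : ∀ {n} {d : Code O n} {xs y} →
                 X ⊢ d ⟨ xs ⟩↓ y → X ⊢ oneOnDomain d ⟨ xs ⟩↓ 1
  oneOnDomain⁺ d↓ = comp↓ (d↓ ∷ []) (computes (constant 1) _)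

  oneOnDomain⁻ : ∀ {n} {d : Code O n} {xs z} →
                 X ⊢ oneOnDomain d ⟨ xs ⟩↓ z → ∃[ y ] X ⊢ d ⟨ xs ⟩↓ y
  oneOnDomain⁻ (comp↓ (d↓ ∷ []) _) = _ , d↓

-- Oracle-free codes under an oracle

module _ {O : Set} where

  -- Reductions and s-m-n functions have oracle-free codes, but the productive function is to be
  -- computed relative to `X`. An oracle call cannot occur in the source, as its index set is empty.
  relativise  : ∀ {n} → Code ⊥ n → Code O n
  relativise* : ∀ {m n} → Vec (Code ⊥ n) m → Vec (Code O n) m
  relativise zer         = zer
  relativise succ        = succ
  relativise (proj i)    = proj i
  relativise (comp c ds) = comp (relativise c) (relativise* ds)
  relativise (prec c d)  = prec (relativise c) (relativise d)
  relativise (mu c)      = mu (relativise c)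
  relativise* []       = []
  relativise* (d ∷ ds) = relativise d ∷ relativise* ds

  module _ (X : Oracles O) where

    relativise-computes  : ∀ {n} {c : Code ⊥ n} {xs y} →
      noOracle ⊢ c ⟨ xs ⟩↓ y → X ⊢ relativise c ⟨ xs ⟩↓ y
    relativise*-computes : ∀ {m n} {ds : Vec (Code ⊥ n) m} {xs ys} →
      Pointwise (λ d y → noOracle ⊢ d ⟨ xs ⟩↓ y) ds ys →
      Pointwise (λ d y → X ⊢ d ⟨ xs ⟩↓ y) (relativise* ds) ys
    relativise-computes zer↓          = zer↓
    relativise-computes succ↓         = succ↓
    relativise-computes proj↓         = proj↓
    relativise-computes (comp↓ ds c)  =
      comp↓ (relativise*-computes ds) (relativise-computes c)
    relativise-computes (prec0↓ c)    = prec0↓ (relativise-computes c)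
    relativise-computes (precS↓ k d)  =
      precS↓ (relativise-computes k) (relativise-computes d)
    relativise-computes (mu↓ below c) = mu↓
      (λ i i<y → map₂ relativise-computes (below i i<y)) (relativise-computes c)
    relativise*-computes []       = []
    relativise*-computes (d ∷ ds) = relativise-computes d ∷ relativise*-computes ds

    Computable-relativise : ∀ {f} → Computable noOracle f → Computable X f
    Computable-relativise (c , correct) = relativise c , relativise-computes ∘ correct

-- Completeness for an acceptable numbering

module _ {O : Set} (X : Oracles O) (X? : ∀ o x → Dec (X o x))
         {φ : Numbering} (acceptable : Acceptable X φ) where

  open Stages X X?
  open Acceptable acceptable

  u : Code O 2
  u = proj₁ universal

  u-correct : ∀ e x y → φ e x y ⇔ X ⊢ u ⟨ e ∷ x ∷ [] ⟩↓ y
  u-correct = proj₂ universal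

  M-Σ₁ : Σ₁ X (M φ)
  -- The constant 2 is the coded result for output 1.
  M-Σ₁ = (λ p s → stage u (p ∷ 0 ∷ []) s ≡ 2) , ComputableRel-stage u 0 2 , λ p → mk⇔
    (λ p∈M → let s₀ , eq = stage-complete (to (u-correct p 0 1) p∈M)
             in s₀ , eq s₀ ≤-refl)
    (λ (s , eq) → from (u-correct p 0 1) (stage-sound u s eq))

  module _ {R} (R-computable : ComputableRel X R) where

    negation : Code O 2
    negation = proj₁ (ComputableRel-¬ X R-computable)

    negation-correct : ∀ n m → (¬ R n m × X ⊢ negation ⟨ n ∷ m ∷ [] ⟩↓ 1)
                               ⊎ (¬ ¬ R n m × X ⊢ negation ⟨ n ∷ m ∷ [] ⟩↓ 0)
    negation-correct = proj₂ (ComputableRel-¬ X R-computable)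

    R? : ∀ n m → Dec (R n m)
    R? = ComputableRel⇒Dec X R-computable

    -- A mu-search stops at 0, so the search for a witness of `R` runs on the characteristic
    -- function of its negation. The search variable comes first; the last argument is a dummy
    -- input.
    test : Code O 3
    test = comp negation (proj (suc zero) ∷ proj zero ∷ [])

    test⁺ : ∀ {m n x v} → X ⊢ negation ⟨ n ∷ m ∷ [] ⟩↓ v → X ⊢ test ⟨ m ∷ n ∷ x ∷ [] ⟩↓ v
    test⁺ d↓ = comp↓ (proj↓ ∷ proj↓ ∷ []) d↓

    mu-test⁺ : ∀ n x → ∃[ m ] R n m → ∃[ y ] X ⊢ mu test ⟨ n ∷ x ∷ [] ⟩↓ y
    mu-test⁺ n x (m , Rnm) =
      -- The rule for `mu` wants nonzero values at all earlier positions, hence the least witness.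
      let y , Rny , below = least (R? n) m Rnm
      in y , mu↓ (λ i i<y → 0 , test-fails i (below i i<y)) (test-succeeds y Rny)
      where
      test-fails : ∀ i → ¬ R n i → X ⊢ test ⟨ i ∷ n ∷ x ∷ [] ⟩↓ 1
      test-fails i ¬Rni with negation-correct n i
      ... | inj₁ (_ , d↓)   = test⁺ d↓
      ... | inj₂ (¬¬R , _)  = contradiction ¬Rni ¬¬R
      test-succeeds : ∀ i → R n i → X ⊢ test ⟨ i ∷ n ∷ x ∷ [] ⟩↓ 0
      test-succeeds i Rni with negation-correct n i
      ... | inj₁ (¬R , _) = contradiction Rni ¬R
      ... | inj₂ (_ , d↓) = test⁺ d↓

    -- If `R` failed at y, the test would also take the value 1 there, against determinism.
    mu-test⁻ : ∀ n x {y} → X ⊢ mu test ⟨ n ∷ x ∷ [] ⟩↓ y → R n y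
    mu-test⁻ n x {y} (mu↓ _ here) with negation-correct n y
    ... | inj₁ (_ , d↓)  = contradiction (deterministic here (test⁺ d↓)) 0≢1+n
    ... | inj₂ (¬¬R , _) = decidable-stable (R? n y) ¬¬R

    -- `f n` indexes a function that is constantly 1 if the search from `n` succeeds and nowhere
    -- defined otherwise.
    ∃-reduces-to-M : ∃[ f ] Computable noOracle f × (∀ n → (∃[ m ] R n m) ⇔ f n ∈ M φ)
    ∃-reduces-to-M =
      let f , f-computable , f-correct = smn (oneOnDomain X (mu test))
      in f , f-computable , λ n → mk⇔
        (λ ∃R → let _ , found = mu-test⁺ n 0 ∃R
                in from (f-correct n 0 1) (oneOnDomain⁺ X found))
        (λ fn∈M → let y , found = oneOnDomain⁻ X (to (f-correct n 0 1) fn∈M)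
                  in y , mu-test⁻ n 0 found)

  M-complete : CompleteFor (Σ₁ X) (M φ)
  M-complete = M-Σ₁ , λ B (R , R-computable , B⇔∃R) →
    let f , f-computable , f-correct = ∃-reduces-to-M R-computable
    in f , f-computable , λ n → mk⇔
      (to (f-correct n) ∘ to (B⇔∃R n))
      (from (B⇔∃R n) ∘ from (f-correct n))

  L-complete : CompleteFor (Π₁ X) (L φ)
  L-complete = Σ₁⇒Π₁-∁ X M-Σ₁ , λ B (R , R-computable , B⇔∀R) →
    let f , f-computable , f-correct = ∃-reduces-to-M (ComputableRel-¬ X R-computable)
        R? = ComputableRel⇒Dec X R-computable
    in f , f-computable , λ n → mk⇔
      (λ n∈B fn∈M → let m , ¬Rnm = from (f-correct n) fn∈M
                    in ¬Rnm (to (B⇔∀R n) n∈B m))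
      -- Non-membership only refutes a counterexample; decidability of `R` turns this into `R n m`.
      (λ fn∉M → from (B⇔∀R n) λ m →
        decidable-stable (R? n m) λ ¬Rnm → fn∉M (to (f-correct n) (m , ¬Rnm)))

  -- Productivity of the complement

  halting-reduces-to-M :
    ∃[ f ] Computable noOracle f × (∀ e → e ∈ W φ e ⇔ f e ∈ M φ)
  halting-reduces-to-M =
    let f , f-computable , f-correct = smn (oneOnDomain X diagonal)
    in f , f-computable , λ e → mk⇔
      (λ (y , φee↓) → from (f-correct e 0 1)
        (oneOnDomain⁺ X (diagonal⁺ (to (u-correct e e y) φee↓))))
      (λ fe∈M → let y , diag↓ = oneOnDomain⁻ X (to (f-correct e 0 1) fe∈M)
                in y , from (u-correct e e y) (diagonal⁻ diag↓))
    where
    diagonal : Code O 2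
    -- The second input is discarded, so testing at input 0 tests convergence of φₑ at e.
    diagonal = comp u (proj zero ∷ proj zero ∷ [])
    diagonal⁺ : ∀ {e x y} → X ⊢ u ⟨ e ∷ e ∷ [] ⟩↓ y → X ⊢ diagonal ⟨ e ∷ x ∷ [] ⟩↓ y
    diagonal⁺ u↓ = comp↓ (proj↓ ∷ proj↓ ∷ []) u↓
    diagonal⁻ : ∀ {e x y} → X ⊢ diagonal ⟨ e ∷ x ∷ [] ⟩↓ y → X ⊢ u ⟨ e ∷ e ∷ [] ⟩↓ y
    diagonal⁻ (comp↓ (proj↓ ∷ proj↓ ∷ []) u↓) = u↓

  W-preimage : ∀ {f} → Computable X f →
    ∃[ s ] Computable noOracle s × (∀ e x → x ∈ W φ (s e) ⇔ f x ∈ W φ e)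
  W-preimage {f} (c , c-computes) =
    let s , s-computable , s-correct = smn u∘f
    in s , s-computable , λ e x → mk⇔
      (λ (y , φ↓) → y , from (u-correct e (f x) y) (u∘f⁻ (to (s-correct e x y) φ↓)))
      (λ (y , φ↓) → y , from (s-correct e x y) (u∘f⁺ (to (u-correct e (f x) y) φ↓)))
    where
    u∘f : Code O 2
    u∘f = comp u (proj zero ∷ comp c (proj (suc zero) ∷ []) ∷ [])
    u∘f⁺ : ∀ {e x y} → X ⊢ u ⟨ e ∷ f x ∷ [] ⟩↓ y → X ⊢ u∘f ⟨ e ∷ x ∷ [] ⟩↓ y
    u∘f⁺ u↓ = comp↓ (proj↓ ∷ comp↓ (proj↓ ∷ []) (c-computes _) ∷ []) u↓
    u∘f⁻ : ∀ {e x y} → X ⊢ u∘f ⟨ e ∷ x ∷ [] ⟩↓ y → X ⊢ u ⟨ e ∷ f x ∷ [] ⟩↓ y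
    u∘f⁻ {x = x} (comp↓ (proj↓ ∷ comp↓ (proj↓ ∷ []) c↓ ∷ []) u↓)
      -- The derivation supplies some output of `c` at x; determinism identifies it with `f x`.
      rewrite deterministic c↓ (c-computes x) = u↓

  L-productive : Productive X φ (L φ)
  L-productive =
    let f , f-computable , f-correct = halting-reduces-to-M
        fˣ = Computable-relativise X f-computable
        s , s-computable , s-correct = W-preimage fˣ
        c , c-computes = fˣ
        d , d-computes = Computable-relativise X s-computable
        outside : ∀ e → W φ e ⊆ L φ → ¬ f (s e) ∈ W φ e
        outside e We⊆L fse∈We = We⊆L fse∈We
          (to (f-correct (s e)) (from (s-correct e (s e)) fse∈We))
    in f ∘ s
     , (comp c (d ∷ []) , λ e → comp↓ (d-computes e ∷ []) (c-computes (s e)))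
     , λ e We⊆L →
         -- Lying in `M` would return the point to `W φ e` through the same two equivalences.
         (λ fse∈M → outside e We⊆L
           (to (s-correct e (s e)) (from (f-correct (s e)) fse∈M)))
         , outside e We⊆L

proposition7p2 : ((φ : Numbering) → Acceptable noOracle φ →
    CompleteFor (Π₁ noOracle) (L φ) × Productive noOracle φ (L φ))
    ×
    (ExcludedMiddle 0ℓ →
    (X : Pred ℕ 0ℓ) (φˣ : Numbering) → Acceptable (oracleFor X) φˣ →
    CompleteFor (Σ₁ (oracleFor X)) (M φˣ)
    × CompleteFor (Π₁ (oracleFor X)) (L φˣ)
    × Productive (oracleFor X) φˣ (L φˣ))
proposition7p2 =
  -- Membership in an empty family of oracles is decided vacuously.
  (λ φ acc → L-complete noOracle (λ ()) acc , L-productive noOracle (λ ()) acc) ,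
  λ em X φˣ acc →
    -- Excluded middle decides the oracle, making its characteristic function available as an Agda
    -- function.
    let X? = λ _ _ → em
    in M-complete (oracleFor X) X? acc
     , L-complete (oracleFor X) X? acc
     , L-productive (oracleFor X) X? acc
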